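{- Let $X$, $Y$ be graphs, let $\varphi:X\to Y$ be a locally surjective homomorphism and let $x\in V_X$. If $x$ is isolated in $X$, then $\varphi(x)$ is isolated in $Y$.
   Context: All graphs are finite, undirected, simple and reflexive: a graph $X=(V_X,E_X)$ has a finite nonempty vertex set $V_X$, and $E_X$ consists of all loops $\{x\}$ ($x\in V_X$; written $\{x,x\}$) together with a (possibly empty) set of $2$-element subsets of $V_X$. A homomorphism $\varphi:X\to Y$ is a map $\varphi:V_X\to V_Y$ such that $\{x_1,x_2\}\in E_X$ implies $\{\varphi(x_1),\varphi(x_2)\}\in E_Y$. $N_X(x)=\{u\in V_X:\{x,u\}\in E_X\}$ (so $x\in N_X(x)$). $\varphi$ is locally surjective if $\varphi(N_X(x))=N_Y(\varphi(x))$ for all $x\in V_X$. A vertex $x$ is isolated in $X$ if the component of $X$ containing $x$ has $x$ as its only vertex. -}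

module Defs where

open import Data.Fin.Base using (Fin)
open import Data.Nat.Base using (ℕ; suc)
open import Data.Product.Base using (∃; _×_)
open import Function.Bundles using (_↔_)
open import Level using (0ℓ)
open import Relation.Binary.Construct.Closure.ReflexiveTransitive using (Star)
open import Relation.Binary.Core using (Rel)
open import Relation.Binary.Definitions
  using (Reflexive; Symmetric; Decidable; Irrelevant)
open import Relation.Binary.PropositionalEquality.Core using (_≡_)
open import Relation.Unary using (Pred; _∈_; _≐_; ｛_｝)

-- `E x y` stands for {x , y} ∈ E_X. Symmetry makes the pair unordered,
-- reflexivity supplies every loop, and decidability together with
-- irrelevance makes E an honest subset, so there are no multiple edges.
record Graph : Set₁ where
  field
    V            : Set
    order-1      : ℕ
    V-finite     : V ↔ Fin (suc order-1)
    E            : Rel V 0ℓ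
    E-refl       : Reflexive E
    E-sym        : Symmetric E
    E-dec        : Decidable E
    E-irrelevant : Irrelevant E

open Graph public using (V)

record Hom (X Y : Graph) : Set where
  field
    ⟦_⟧      : V X → V Y
    preserves : ∀ {x₁ x₂} → Graph.E X x₁ x₂ → Graph.E Y (⟦_⟧ x₁) (⟦_⟧ x₂)

open Hom public using (⟦_⟧)

N : (X : Graph) → V X → Pred (V X) 0ℓ
N X x u = Graph.E X x u

image : {A B : Set} → (A → B) → Pred A 0ℓ → Pred B 0ℓ
image f P b = ∃ λ a → a ∈ P × f a ≡ b

LocallySurjective : {X Y : Graph} → Hom X Y → Set
LocallySurjective {X} {Y} φ = ∀ x → image ⟦ φ ⟧ (N X x) ≐ N Y (⟦ φ ⟧ x)

-- The vertex set of the connected component containing x: all vertices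
-- joined to x by a finite walk.
component : (X : Graph) → V X → Pred (V X) 0ℓ
component X x y = Star (Graph.E X) x y

Isolated : (X : Graph) → V X → Set
Isolated X x = component X x ≐ ｛ x ｝

{-# OPTIONS --safe #-}
-- Local surjectivity lifts walks from Y to X edge by edge, so the component of
-- φ x is covered by the image of the component of x, here the single vertex φ x.
module Submission where

open import Data.Product.Base using (_,_; proj₁; proj₂)
open import Relation.Binary.Construct.Closure.ReflexiveTransitive using (ε; _◅_)
open import Relation.Binary.PropositionalEquality.Core using (_≡_; refl; cong; trans)
open import Relation.Unary using (_⊆_)

open import Defs

-- A walk from `⟦ φ ⟧ x` lifts to a walk from `x`. If `x` is isolated, the lift ends at `x`, so the
-- original walk ends at `⟦ φ ⟧ x`.

component-⊆-image : {X Y : Graph} (φ : Hom X Y) → LocallySurjective φ →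
    (x : V X) → component Y (⟦ φ ⟧ x) ⊆ image ⟦ φ ⟧ (component X x)
component-⊆-image φ surj x ε = x , ε , refl
component-⊆-image φ surj x (e ◅ walk) with proj₂ (surj x) e
-- `u` is a neighbour of `x` over the second vertex of the walk; matching `refl` makes that vertex
-- `⟦ φ ⟧ u`, so the rest of the walk can be lifted from `u`.
... | u , xu , refl with component-⊆-image φ surj u walk
...   | v , walk′ , φv≡y = v , xu ◅ walk′ , φv≡y

corollary5p12 : (X Y : Graph) (φ : Hom X Y) → LocallySurjective φ →
    (x : V X) → Isolated X x → Isolated Y (⟦ φ ⟧ x)
corollary5p12 X Y φ surj x isolated = component⊆ , λ { refl → ε }
  where
  component⊆ : ∀ {y} → component Y (⟦ φ ⟧ x) y → ⟦ φ ⟧ x ≡ y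
  component⊆ walk with component-⊆-image φ surj x walk
  -- Isolation of `x` forces `x ≡ v` for the endpoint `v` of the lift.
  ... | v , walk′ , φv≡y = trans (cong ⟦ φ ⟧ (proj₁ isolated walk′)) φv≡y
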